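{- Let $m,n\geq2$, $d,t\geq0$, and $j\geq1$. Then the number of Fibonacci polyominoes $P\in\mathcal F_{m,n}$ with $\operatorname{des}(P)=d$, $\operatorname{lmin}(P)=j$ and $\operatorname{lev}(P)=t$ equals \[ S_{m,n-m-1}(d,j,t)+S_{m-1,n-m}(d-1,j-1,t). \]
   Context: A Fibonacci polyomino is a (nonempty) polyomino, considered up to translation, that is column-convex (each column is a contiguous segment of unit cells) and such that, reading columns from left to right, the bottom cell of each column lies exactly one unit above the bottom cell of the preceding column. Equivalently, it is given by a sequence of column heights $(h_1,\dots,h_m)$, $m\ge 1$, with $h_i\ge 2$ for $1\le i\le m-1$ and $h_m\ge 1$; column $i$ consists of the cells in column position $i$ and rows $i,i+1,\dots,i+h_i-1$. The horizontal (resp. vertical) semiperimeter is half the number of horizontal (resp. vertical) unit edges on the boundary (edges belonging to exactly one cell). $\mathcal F_{m,n}$ is the set of Fibonacci polyominoes with horizontal semiperimeter $m$ (equivalently $m$ columns) and vertical semiperimeter $n$. For $P$ with column heights $(h_1,\ldots,h_m)$: $\operatorname{des}(P)=|\{i:1\le i<m,\ h_i>h_{i+1}\}|$; $\operatorname{lev}(P)=|\{i:1\le i<m,\ h_i=h_{i+1}\}|$; $\operatorname{lmin}(P)$ is the number of columns $i$ such that $i=1$ or $h_i<\min\{h_1,\ldots,h_{i-1}\}$. Write $(n)_+=\max\{n,0\}$. For a sequence $\mathbf a=(a_1,\ldots,a_\ell)$ of nonnegative integers: $\operatorname{exc}(\mathbf a)=a_1+\sum_{j=2}^{\ell}(a_j-a_{j-1}-1)_+$;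 $\operatorname{asc}(\mathbf a)=|\{j:1\le j<\ell,\ a_j<a_{j+1}\}|$; $\operatorname{lev}(\mathbf a)=|\{j:1\le j<\ell,\ a_j=a_{j+1}\}|$; $\operatorname{rlmin}(\mathbf a)$ is the number of indices $i$ with $a_i<a_j$ for all $j>i$. For $\ell\ge1$, $S_{\ell,r}(d,j,t)$ is the number of sequences $\mathbf a$ of $\ell$ nonnegative integers with $\operatorname{exc}(\mathbf a)=r$, $\operatorname{asc}(\mathbf a)=d$, $\operatorname{rlmin}(\mathbf a)=j$, $\operatorname{lev}(\mathbf a)=t$; it is $0$ whenever a parameter is outside its natural range, in particular when $r<0$, $d<0$, $j<0$ or $t<0$. -}

module Defs where

open import Data.Bool using (if_then_else_)
open import Data.Fin using (Fin)
open import Data.Integer using (ℤ; +_)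
open import Data.List using (List; []; _∷_; _++_; concatMap; drop; filter; length; map; upTo; zip)
open import Data.List.Membership.DecPropositional using (_∈?_)
open import Data.List.Relation.Unary.All using (all?)
open import Data.Nat using (ℕ; suc; _+_; _*_; _∸_; _⊓_; _≤_; _≟_; _<?_)
open import Data.Nat.ListAction using (sum)
open import Data.Product using (_×_; _,_; proj₁; proj₂; Σ-syntax)
open import Data.Product.Properties using (≡-dec)
open import Function.Bundles using (_↔_)
open import Relation.Binary.Definitions using (DecidableEquality)
open import Relation.Binary.PropositionalEquality using (_≡_)
open import Relation.Nullary.Decidable using (does)

infix 4 _HasCardinality_ _∈𝓕[_,_]

_HasCardinality_ : Set → ℕ → Set
A HasCardinality k = A ↔ Fin k

-- (x₁ , x₂) , (x₂ , x₃) , … , (xₗ₋₁ , xₗ)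
consecutive : List ℕ → List (ℕ × ℕ)
consecutive xs = zip xs (drop 1 xs)

-- There is no constructor for [], so in before the tail is nonempty and h is
-- not the last height.
data FibonacciHeights : List ℕ → Set where
  last   : ∀ {h} → 1 ≤ h → FibonacciHeights (h ∷ [])
  before : ∀ {h hs} → 2 ≤ h → FibonacciHeights hs → FibonacciHeights (h ∷ hs)

-- A translation class, represented by its column heights from left to right.
record FibonacciPolyomino : Set where
  constructor polyomino
  field
    heights   : List ℕ
    fibonacci : FibonacciHeights heights

open FibonacciPolyomino public

-- (x , y) is the unit square in column x and row y, with lower left corner
-- at the lattice point (x , y).
Cell : Set
Cell = ℕ × ℕ

-- A unit edge, named by its left (if horizontal) or lower (if vertical) endpoint.
Edge : Set
Edge = ℕ × ℕ

_≟ᴱ_ : DecidableEquality Edge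
_≟ᴱ_ = ≡-dec _≟_ _≟_

horizontalEdges : Cell → List Edge
horizontalEdges (x , y) = (x , y) ∷ (x , suc y) ∷ []

verticalEdges : Cell → List Edge
verticalEdges (x , y) = (x , y) ∷ (suc x , y) ∷ []

-- The columns number i, i + 1, …, where column i occupies rows i, …, i + h - 1.
cellsFrom : ℕ → List ℕ → List Cell
cellsFrom i []       = []
cellsFrom i (h ∷ hs) = map (λ k → (i , i + k)) (upTo h) ++ cellsFrom (suc i) hs

cells : FibonacciPolyomino → List Cell
cells P = cellsFrom 1 (heights P)

-- An edge occurs in concatMap edgesOf cs once for every cell it belongs to, so
-- each edge kept by the filter is listed exactly once.
boundaryEdges : (Cell → List Edge) → List Cell → List Edge
boundaryEdges edgesOf cs =
  filter (λ e → length (filter (λ c → _∈?_ _≟ᴱ_ e (edgesOf c)) cs) ≟ 1)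
         (concatMap edgesOf cs)

-- Semiperimeters are halves of edge counts; the equations are multiplied by 2
-- so that no rounding is involved.
_∈𝓕[_,_] : FibonacciPolyomino → ℕ → ℕ → Set
P ∈𝓕[ m , n ] =
  length (boundaryEdges horizontalEdges (cells P)) ≡ 2 * m ×
  length (boundaryEdges verticalEdges (cells P)) ≡ 2 * n

des : List ℕ → ℕ
des hs = length (filter (λ p → proj₂ p <? proj₁ p) (consecutive hs))

asc : List ℕ → ℕ
asc as = length (filter (λ p → proj₁ p <? proj₂ p) (consecutive as))

lev : List ℕ → ℕ
lev as = length (filter (λ p → proj₁ p ≟ proj₂ p) (consecutive as))

-- The first argument is the minimum of all preceding entries.
newMinima : ℕ → List ℕ → ℕ
newMinima μ []       = 0
newMinima μ (h ∷ hs) = (if does (h <? μ) then 1 else 0) + newMinima (μ ⊓ h) hs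

lmin : List ℕ → ℕ
lmin []       = 0
lmin (h ∷ hs) = 1 + newMinima h hs

rlmin : List ℕ → ℕ
rlmin []       = 0
rlmin (a ∷ as) = (if does (all? (a <?_) as) then 1 else 0) + rlmin as

-- Truncated subtraction gives b ∸ a ∸ 1 = max (b - a - 1) 0.
exc : List ℕ → ℕ
exc []       = 0
exc (a ∷ as) = a + sum (map (λ p → proj₂ p ∸ proj₁ p ∸ 1) (consecutive (a ∷ as)))

-- The set counted by S_{ℓ,r}(d,j,t). The parameters are integers, and the set
-- is empty when one of them is negative.
Sequences : (ℓ : ℕ) (r d j t : ℤ) → Set
Sequences ℓ r d j t =
  Σ[ as ∈ List ℕ ]
    (length as ≡ ℓ × + exc as ≡ r × + asc as ≡ d × + rlmin as ≡ j × + lev as ≡ t)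

{-# OPTIONS --safe #-}

-- In the column heights (h₁, …, hₘ), neighbouring columns i and i + 1 share
-- min (hᵢ - 1, hᵢ₊₁) vertical edges, so the vertical semiperimeter is
-- Σ hᵢ - Σ min (hᵢ - 1, hᵢ₊₁) = hₘ + (m - 1) + Σ (hᵢ - hᵢ₊₁ - 1)₊,
-- which is m - 1 plus exc of the heights read from right to left. Reading
-- backwards also turns des into asc and lmin into rlmin and keeps lev. If
-- hₘ ≥ 2, subtracting 2 from all heights gives the sequences of the first
-- summand. If hₘ = 1, delete this column first: it is a new minimum below its
-- left neighbour, so it accounts for one descent and one left-to-right minimum;
-- this gives the second summand.
module Submission where

open import Defs
import Data.Integer as ℤ
import Data.Integer.Properties as ℤ
import Data.List.Relation.Unary.All.Properties as All
import Data.Nat.Properties as ℕ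
open import Algebra.Properties.AbelianGroup ℤ.+-0-abelianGroup using (//-rightDividesˡ; //-rightDividesʳ)
open import Algebra.Properties.CommutativeSemigroup ℕ.+-commutativeSemigroup using (interchange; x∙yz≈y∙xz)
open import Data.Bool using (true; false; if_then_else_)
open import Data.Fin using (Fin; zero; suc)
open import Data.Fin.Properties using (+↔⊎)
open import Data.Integer using (ℤ; +_; _-_; 1ℤ; ∣_∣)
open import Data.List using (List; []; _∷_; _++_; _∷ʳ_; _ʳ++_; applyUpTo; cartesianProductWith; concat; concatMap; deduplicate; filter; length; lookup; map; reverse; upTo)
open import Data.List.Membership.DecPropositional _≟ᴱ_ using (_∈?_)
open import Data.List.Membership.Propositional using (_∈_)
open import Data.List.Membership.Propositional.Properties using (∈-cartesianProductWith⁺; ∈-deduplicate⁺; ∈-deduplicate⁻; ∈-filter⁺; ∈-filter⁻; ∈-lookup; ∈-upTo⁺)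
open import Data.List.Properties using (concat-++; filter-++; length-++; length-map; length-reverse; map-++; map-id; map-injective; map-upTo; reverse-++; reverse-injective; reverse-involutive; ∷-injectiveʳ; ≡-dec)
open import Data.List.Relation.Unary.All as All using (All; []; _∷_; all?)
open import Data.List.Relation.Unary.AllPairs using (_∷_)
open import Data.List.Relation.Unary.Any using (here; there; index)
open import Data.List.Relation.Unary.Any.Properties using (lookup-index)
open import Data.List.Relation.Unary.Unique.DecPropositional.Properties using (deduplicate-!)
open import Data.List.Relation.Unary.Unique.Propositional using (Unique)
open import Data.Nat using (ℕ; zero; suc; _+_; _*_; _∸_; _⊓_; _≤_; _<_; _≟_; _<?_; z≤n; s≤s)
open import Data.Nat.ListAction using (sum)
open import Data.Nat.Properties using
  ( +-assoc; +-cancelˡ-≡; +-comm; +-identityʳ; +-monoʳ-≤; +-monoˡ-≤; +-suc; *-cancelˡ-≡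
  ; *-distribˡ-+; 0≢1+n; 1+n≢0; <-irrefl; <-≤-trans; <⇒≢; <⇒≤; m<n⇒m<1+n; m≤m+n; m≤n+m∸n
  ; m⊓n≤m; m⊓n≤n; n<1+n; n≤1+n; suc-injective; ∸-+-assoc; ≡-irrelevant; ≤-irrelevant
  ; ≤-refl; ≤-trans; ⊓-glb; module ≤-Reasoning
  )
open import Data.Nat.Tactic.RingSolver using (solve-∀)
open import Data.Product using (_×_; _,_; proj₁; proj₂; Σ-syntax; ∃; ∃₂; swap)
open import Data.Product.Function.NonDependent.Propositional using (_×-⇔_)
open import Data.Product.Properties using (,-injectiveʳ)
open import Data.Sum using (_⊎_; inj₁; inj₂)
open import Data.Sum.Function.Propositional using (_⊎-↔_)
open import Function using (_∘_; id)
open import Function.Bundles using (_⇔_; mk⇔; Equivalence; _↔_; mk⤖)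
open import Function.Construct.Composition using () renaming (_⇔-∘_ to infixr 8 _⇔-∘_; _↔-∘_ to infixr 8 _↔-∘_)
open import Function.Construct.Symmetry using (↔-sym)
open import Function.Definitions using (Injective)
open import Function.Properties.Bijection using (⤖⇒↔)
open import Relation.Binary.Definitions using (DecidableEquality)
open import Relation.Binary.PropositionalEquality using (_≡_; _≢_; refl; sym; trans; cong; cong₂; subst; module ≡-Reasoning)
open import Relation.Nullary using (¬_; Dec; contradiction)
open import Relation.Nullary.Decidable using (does; dec-true; dec-false; does-⇔; _×-dec_)
open import Relation.Unary using (Decidable)

-- Counting list entries by indicators

⟦_⟧ : {P : Set} → Dec P → ℕ
⟦ P? ⟧ = if does P? then 1 else 0

⟦⟧-true : {P : Set} (P? : Dec P) → P → ⟦ P? ⟧ ≡ 1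
⟦⟧-true P? p = cong (if_then 1 else 0) (dec-true P? p)

⟦⟧-false : {P : Set} (P? : Dec P) → ¬ P → ⟦ P? ⟧ ≡ 0
⟦⟧-false P? ¬p = cong (if_then 1 else 0) (dec-false P? ¬p)

⟦⟧-cong : {P Q : Set} → P ⇔ Q → (P? : Dec P) (Q? : Dec Q) → ⟦ P? ⟧ ≡ ⟦ Q? ⟧
⟦⟧-cong P⇔Q P? Q? = cong (if_then 1 else 0) (does-⇔ P⇔Q P? Q?)

module _ {A : Set} {P : A → Set} (P? : Decidable P) where

  count : List A → ℕ
  count xs = length (filter P? xs)

  count-∷ : ∀ x xs → count (x ∷ xs) ≡ ⟦ P? x ⟧ + count xs
  count-∷ x xs with does (P? x)
  ... | true  = refl
  ... | false = refl

  count-++ : ∀ xs ys → count (xs ++ ys) ≡ count xs + count ys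
  count-++ xs ys = trans (cong length (filter-++ P? xs ys)) (length-++ (filter P? xs))

  count-applyUpTo-none : ∀ (f : ℕ → A) n → (∀ k → ¬ P (f k)) → count (applyUpTo f n) ≡ 0
  count-applyUpTo-none f zero    ¬P = refl
  count-applyUpTo-none f (suc n) ¬P = trans (count-∷ _ _)
    (cong₂ _+_ (⟦⟧-false (P? _) (¬P 0)) (count-applyUpTo-none (f ∘ suc) n (¬P ∘ suc)))

  -- In use, `f` lists the cells of a column and `k₀` is the only position whose cell can contain a
  -- given edge; the count is 0 when the column is too short to reach it.
  count-applyUpTo-one : ∀ (f : ℕ → A) n k₀ → (∀ k → P (f k) ⇔ k ≡ k₀) →
    count (applyUpTo f n) ≡ ⟦ k₀ <? n ⟧
  count-applyUpTo-one f zero    k₀       P⇔ = refl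
  count-applyUpTo-one f (suc n) zero     P⇔ = trans (count-∷ _ _)
    (cong₂ _+_ (⟦⟧-true (P? _) (from (P⇔ 0) refl))
      (count-applyUpTo-none (f ∘ suc) n λ k p → 1+n≢0 (to (P⇔ (suc k)) p)))
    where open Equivalence
  count-applyUpTo-one f (suc n) (suc k₀) P⇔ = trans (count-∷ _ _)
    (cong₂ _+_ (⟦⟧-false (P? _) λ p → 0≢1+n (to (P⇔ 0) p))
      (count-applyUpTo-one (f ∘ suc) n k₀ λ k →
        mk⇔ (λ p → suc-injective (to (P⇔ (suc k)) p)) (λ eq → from (P⇔ (suc k)) (cong suc eq))))
    where open Equivalence

  -- Meant for a horizontal edge above the bottom of a column: it is the top of cell `k₀` and the
  -- bottom of cell `suc k₀`, and each of these counts only if the column reaches it.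
  count-applyUpTo-two : ∀ (f : ℕ → A) n k₀ → (∀ k → P (f k) ⇔ (k ≡ k₀ ⊎ k ≡ suc k₀)) →
    count (applyUpTo f n) ≡ ⟦ k₀ <? n ⟧ + ⟦ suc k₀ <? n ⟧
  count-applyUpTo-two f zero    k₀       P⇔ = refl
  count-applyUpTo-two f (suc n) zero     P⇔ = trans (count-∷ _ _)
    (cong₂ _+_ (⟦⟧-true (P? _) (from (P⇔ 0) (inj₁ refl)))
      (count-applyUpTo-one (f ∘ suc) n 0 λ k →
        mk⇔ (λ p → one (to (P⇔ (suc k)) p)) (λ eq → from (P⇔ (suc k)) (inj₂ (cong suc eq)))))
    where
    open Equivalence
    one : ∀ {k} → suc k ≡ 0 ⊎ suc k ≡ 1 → k ≡ 0
    one (inj₂ refl) = refl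
  count-applyUpTo-two f (suc n) (suc k₀) P⇔ = trans (count-∷ _ _)
    (cong₂ _+_ (⟦⟧-false (P? _) λ p → absurd (to (P⇔ 0) p))
      (count-applyUpTo-two (f ∘ suc) n k₀ λ k →
        mk⇔ (λ p → pred-either (to (P⇔ (suc k)) p))
            (λ { (inj₁ eq) → from (P⇔ (suc k)) (inj₁ (cong suc eq))
               ; (inj₂ eq) → from (P⇔ (suc k)) (inj₂ (cong suc eq)) })))
    where
    open Equivalence
    absurd : ¬ (0 ≡ suc k₀ ⊎ 0 ≡ suc (suc k₀))
    absurd (inj₁ ())
    absurd (inj₂ ())
    pred-either : ∀ {k} → suc k ≡ suc k₀ ⊎ suc k ≡ suc (suc k₀) → k ≡ k₀ ⊎ k ≡ suc k₀
    pred-either (inj₁ refl) = inj₁ refl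
    pred-either (inj₂ refl) = inj₂ refl

-- Sums of boundary indicators

∑ : (ℕ → ℕ) → ℕ → ℕ
∑ f zero    = 0
∑ f (suc n) = f 0 + ∑ (f ∘ suc) n

∑-cong : ∀ {f g} n → (∀ k → f k ≡ g k) → ∑ f n ≡ ∑ g n
∑-cong zero    f≗g = refl
∑-cong (suc n) f≗g = cong₂ _+_ (f≗g 0) (∑-cong n (f≗g ∘ suc))

∑-+ : ∀ f g n → ∑ (λ k → f k + g k) n ≡ ∑ f n + ∑ g n
∑-+ f g zero    = refl
∑-+ f g (suc n) = trans (cong (λ s → f 0 + g 0 + s) (∑-+ (f ∘ suc) (g ∘ suc) n))
  (interchange (f 0) (g 0) _ _)

is1 : ℕ → ℕ
is1 v = ⟦ v ≟ 1 ⟧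

-- The second indicator is 1 on the whole range, so a term is 1 exactly when `k` is at least `q`.
-- This counts the free ones among `n` vertical sides of which a neighbour covers the lowest `q`.
∑-is1-outside : ∀ q n → ∑ (λ k → is1 (⟦ k <? q ⟧ + ⟦ k <? n ⟧)) n ≡ n ∸ q
∑-is1-outside zero    zero    = refl
∑-is1-outside (suc q) zero    = refl
∑-is1-outside zero    (suc n) = cong suc (∑-is1-outside zero n)
∑-is1-outside (suc q) (suc n) = ∑-is1-outside q n

-- Every `k` below `n` gives multiplicity 2; only `k = n`, the top of the column, gives 1.
∑-is1-last : ∀ n → ∑ (λ k → is1 (⟦ k <? suc n ⟧ + ⟦ k <? n ⟧)) (suc n) ≡ 1
∑-is1-last zero    = refl
∑-is1-last (suc n) = ∑-is1-last n

∑-is1-inner : ∀ n → ∑ (λ k → is1 (⟦ k <? suc n ⟧ + ⟦ k <? n ⟧)) n ≡ 0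
∑-is1-inner zero    = refl
∑-is1-inner (suc n) = ∑-is1-inner n

-- Columns and edge multiplicities

column : ℕ → ℕ → List Cell
column i h = applyUpTo (λ k → (i , i + k)) h

cellsFrom-∷ : ∀ i h hs → cellsFrom i (h ∷ hs) ≡ column i h ++ cellsFrom (suc i) hs
cellsFrom-∷ i h hs = cong (_++ cellsFrom (suc i) hs) (map-upTo _ h)

multiplicity : (Cell → List Edge) → List Cell → Edge → ℕ
multiplicity edgesOf cs e = count (λ c → e ∈? edgesOf c) cs

multiplicity-cellsFrom-∷ : ∀ edgesOf i h hs e →
  multiplicity edgesOf (cellsFrom i (h ∷ hs)) e ≡
  multiplicity edgesOf (column i h) e + multiplicity edgesOf (cellsFrom (suc i) hs) e
multiplicity-cellsFrom-∷ edgesOf i h hs e =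
  trans (cong (λ cs → multiplicity edgesOf cs e) (cellsFrom-∷ i h hs))
        (count-++ (λ c → e ∈? edgesOf c) (column i h) _)

-- Abstracts the filter of `boundaryEdges` over the multiplicity, so that the list of edges can
-- shrink column by column while `M` still refers to the whole polyomino.
simple : (Edge → ℕ) → List Edge → ℕ
simple M = count (λ e → M e ≟ 1)

-- The list alternates between the two edges of each cell; separating them leaves bottoms and tops,
-- or left and right sides, to be summed independently.
simple-column : ∀ (M : Edge → ℕ) (e₁ e₂ : Cell → Edge) (f : ℕ → Cell) n →
  simple M (concatMap (λ c → e₁ c ∷ e₂ c ∷ []) (applyUpTo f n)) ≡
  ∑ (λ k → is1 (M (e₁ (f k)))) n + ∑ (λ k → is1 (M (e₂ (f k)))) n
simple-column M e₁ e₂ f n = trans (unfold f n) (∑-+ _ _ n)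
  where
  unfold : ∀ f n →
    simple M (concatMap (λ c → e₁ c ∷ e₂ c ∷ []) (applyUpTo f n)) ≡
    ∑ (λ k → is1 (M (e₁ (f k))) + is1 (M (e₂ (f k)))) n
  unfold f zero    = refl
  unfold f (suc n) = begin
    simple M (e₁ (f 0) ∷ e₂ (f 0) ∷ rest) ≡⟨ count-∷ M1? _ (e₂ (f 0) ∷ rest) ⟩
    b₁ + simple M (e₂ (f 0) ∷ rest)       ≡⟨ cong (λ s → b₁ + s) (count-∷ M1? _ rest) ⟩
    b₁ + (b₂ + simple M rest)             ≡⟨ cong (λ s → b₁ + (b₂ + s)) (unfold (f ∘ suc) n) ⟩
    b₁ + (b₂ + ∑ _ n)                     ≡⟨ +-assoc b₁ b₂ _ ⟨
    b₁ + b₂ + ∑ _ n ∎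
    where
    open ≡-Reasoning
    M1? : Decidable (λ e → M e ≡ 1)
    M1? e = M e ≟ 1
    rest = concatMap (λ c → e₁ c ∷ e₂ c ∷ []) (applyUpTo (f ∘ suc) n)
    b₁ = is1 (M (e₁ (f 0)))
    b₂ = is1 (M (e₂ (f 0)))

simple-cellsFrom-∷ : ∀ M edgesOf i h hs →
  simple M (concatMap edgesOf (cellsFrom i (h ∷ hs))) ≡
  simple M (concatMap edgesOf (column i h)) + simple M (concatMap edgesOf (cellsFrom (suc i) hs))
simple-cellsFrom-∷ M edgesOf i h hs = begin
  simple M (concatMap edgesOf (cellsFrom i (h ∷ hs)))
    ≡⟨ cong (simple M ∘ concatMap edgesOf) (cellsFrom-∷ i h hs) ⟩
  simple M (concatMap edgesOf (column i h ++ rest))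
    ≡⟨ cong (simple M ∘ concat) (map-++ edgesOf (column i h) rest) ⟩
  simple M (concat (map edgesOf (column i h) ++ map edgesOf rest))
    ≡⟨ cong (simple M) (concat-++ (map edgesOf (column i h)) (map edgesOf rest)) ⟨
  simple M (concatMap edgesOf (column i h) ++ concatMap edgesOf rest)
    ≡⟨ count-++ _ (concatMap edgesOf (column i h)) _ ⟩
  simple M (concatMap edgesOf (column i h)) + simple M (concatMap edgesOf rest) ∎
  where
  open ≡-Reasoning
  rest = cellsFrom (suc i) hs

-- Horizontal edges

multiplicityH-column-bottom : ∀ i h → multiplicity horizontalEdges (column i h) (i , i + 0) ≡ ⟦ 0 <? h ⟧
multiplicityH-column-bottom i h = count-applyUpTo-one _ _ h 0 λ k → mk⇔ (to k) λ { refl → here refl }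
  where
  to : ∀ k → (i , i + 0) ∈ horizontalEdges (i , i + k) → k ≡ 0
  to k (here eq)         = sym (+-cancelˡ-≡ i 0 k (,-injectiveʳ eq))
  to k (there (here eq)) with () ← +-cancelˡ-≡ i 0 (suc k) (trans (,-injectiveʳ eq) (sym (+-suc i k)))

multiplicityH-column-above : ∀ i h k₀ →
  multiplicity horizontalEdges (column i h) (i , i + suc k₀) ≡ ⟦ k₀ <? h ⟧ + ⟦ suc k₀ <? h ⟧
multiplicityH-column-above i h k₀ = count-applyUpTo-two _ _ h k₀ λ k → mk⇔ (to k)
  λ { (inj₁ refl) → there (here (cong (i ,_) (+-suc i k))) ; (inj₂ refl) → here refl }
  where
  to : ∀ k → (i , i + suc k₀) ∈ horizontalEdges (i , i + k) → k ≡ k₀ ⊎ k ≡ suc k₀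
  to k (here eq)         = inj₂ (sym (+-cancelˡ-≡ i (suc k₀) k (,-injectiveʳ eq)))
  to k (there (here eq)) with refl ← +-cancelˡ-≡ i (suc k₀) (suc k) (trans (,-injectiveʳ eq) (sym (+-suc i k)))
    = inj₁ refl

multiplicityH-column-other : ∀ i h {x} y → x ≢ i → multiplicity horizontalEdges (column i h) (x , y) ≡ 0
multiplicityH-column-other i h y x≢i = count-applyUpTo-none _ _ h
  λ { k (here refl) → x≢i refl ; k (there (here refl)) → x≢i refl }

multiplicityH-left : ∀ i hs {x} y → x < i → multiplicity horizontalEdges (cellsFrom i hs) (x , y) ≡ 0
multiplicityH-left i []       y x<i = refl
multiplicityH-left i (h ∷ hs) y x<i = trans (multiplicity-cellsFrom-∷ _ i h hs _)
  (cong₂ _+_ (multiplicityH-column-other i h y (<⇒≢ x<i)) (multiplicityH-left (suc i) hs y (m<n⇒m<1+n x<i)))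

-- M is the multiplicity in the whole polyomino, of which cellsFrom i hs is the
-- part still to be scanned.
simpleH-cellsFrom : ∀ (M : Edge → ℕ) i {hs} → All (1 ≤_) hs →
  (∀ {x} y → i ≤ x → M (x , y) ≡ multiplicity horizontalEdges (cellsFrom i hs) (x , y)) →
  simple M (concatMap horizontalEdges (cellsFrom i hs)) ≡ 2 * length hs
simpleH-cellsFrom M i [] M≡ = refl
simpleH-cellsFrom M i {suc h ∷ hs} (_ ∷ pos) M≡ = begin
  simple M (concatMap horizontalEdges (cellsFrom i (suc h ∷ hs)))
    ≡⟨ simple-cellsFrom-∷ M _ i (suc h) hs ⟩
  simple M (concatMap horizontalEdges (column i (suc h))) + _
    ≡⟨ cong₂ _+_ (simple-column M _ _ (λ k → (i , i + k)) (suc h)) (simpleH-cellsFrom M (suc i) pos M≡′) ⟩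
  (∑ (λ k → is1 (M (i , i + k))) (suc h) + ∑ (λ k → is1 (M (i , suc (i + k)))) (suc h)) + 2 * length hs
    ≡⟨ cong (_+ 2 * length hs) (cong₂ _+_ bottoms tops) ⟩
  2 + 2 * length hs
    ≡⟨ *-distribˡ-+ 2 1 (length hs) ⟨
  2 * suc (length hs) ∎
  where
  open ≡-Reasoning
  M≡′ : ∀ {x} y → suc i ≤ x → M (x , y) ≡ multiplicity horizontalEdges (cellsFrom (suc i) hs) (x , y)
  M≡′ {x} y i<x = trans (M≡ y (<⇒≤ i<x)) (trans (multiplicity-cellsFrom-∷ horizontalEdges i (suc h) hs (x , y))
    (cong (_+ multiplicity horizontalEdges (cellsFrom (suc i) hs) (x , y))
          (multiplicityH-column-other i (suc h) y (<⇒≢ i<x ∘ sym))))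
  here≡ : ∀ y → M (i , y) ≡ multiplicity horizontalEdges (column i (suc h)) (i , y)
  here≡ y = trans (M≡ y ≤-refl) (trans (multiplicity-cellsFrom-∷ horizontalEdges i (suc h) hs (i , y))
    (trans (cong (λ s → multiplicity horizontalEdges (column i (suc h)) (i , y) + s)
      (multiplicityH-left (suc i) hs y (n<1+n i))) (+-identityʳ _)))
  above : ∀ k → M (i , i + suc k) ≡ ⟦ k <? suc h ⟧ + ⟦ k <? h ⟧
  above k = trans (here≡ _) (multiplicityH-column-above i (suc h) k)
  -- The lowest bottom edge is free; every other bottom edge is also the top of the cell beneath it.
  bottoms : ∑ (λ k → is1 (M (i , i + k))) (suc h) ≡ 1
  bottoms = cong₂ _+_ (cong is1 (trans (here≡ _) (multiplicityH-column-bottom i (suc h))))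
    (trans (∑-cong h (λ k → cong is1 (above k))) (∑-is1-inner h))
  -- The same edges shifted by one: now only the highest is free.
  tops : ∑ (λ k → is1 (M (i , suc (i + k)))) (suc h) ≡ 1
  tops = trans (∑-cong (suc h) (λ k → cong is1 (trans (cong (λ y → M (i , y)) (sym (+-suc i k))) (above k))))
    (∑-is1-last h)

-- Vertical edges

multiplicityV-column-side : ∀ i h {x} k₀ → x ≡ i ⊎ x ≡ suc i →
  multiplicity verticalEdges (column i h) (x , i + k₀) ≡ ⟦ k₀ <? h ⟧
multiplicityV-column-side i h {x} k₀ side = count-applyUpTo-one _ _ h k₀ λ k → mk⇔ (to k) (from side)
  where
  to : ∀ k → (x , i + k₀) ∈ verticalEdges (i , i + k) → k ≡ k₀
  to k (here eq)         = sym (+-cancelˡ-≡ i k₀ k (,-injectiveʳ eq))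
  to k (there (here eq)) = sym (+-cancelˡ-≡ i k₀ k (,-injectiveʳ eq))
  from : ∀ {x k} → x ≡ i ⊎ x ≡ suc i → k ≡ k₀ → (x , i + k₀) ∈ verticalEdges (i , i + k)
  from (inj₁ refl) refl = here refl
  from (inj₂ refl) refl = there (here refl)

multiplicityV-column-below : ∀ i h x {y} → y < i → multiplicity verticalEdges (column i h) (x , y) ≡ 0
multiplicityV-column-below i h x y<i = count-applyUpTo-none _ _ h
  λ { k (here refl) → <-irrefl refl (≤-trans y<i (m≤m+n i k))
    ; k (there (here refl)) → <-irrefl refl (≤-trans y<i (m≤m+n i k)) }

multiplicityV-column-other : ∀ i h {x} y → x ≢ i → x ≢ suc i →
  multiplicity verticalEdges (column i h) (x , y) ≡ 0
multiplicityV-column-other i h y x≢i x≢1+i = count-applyUpTo-none _ _ h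
  λ { k (here refl) → x≢i refl ; k (there (here refl)) → x≢1+i refl }

multiplicityV-left : ∀ i hs {x} y → x < i → multiplicity verticalEdges (cellsFrom i hs) (x , y) ≡ 0
multiplicityV-left i []       y x<i = refl
multiplicityV-left i (h ∷ hs) y x<i = trans (multiplicity-cellsFrom-∷ _ i h hs _)
  (cong₂ _+_ (multiplicityV-column-other i h y (<⇒≢ x<i) (<⇒≢ (m<n⇒m<1+n x<i)))
             (multiplicityV-left (suc i) hs y (m<n⇒m<1+n x<i)))

-- An absent column counts as a column of height 0.
firstHeight : List ℕ → ℕ
firstHeight []      = 0
firstHeight (h ∷ _) = h

multiplicityV-first : ∀ i hs y →
  multiplicity verticalEdges (cellsFrom i hs) (i , y) ≡
  multiplicity verticalEdges (column i (firstHeight hs)) (i , y)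
multiplicityV-first i []       y = refl
multiplicityV-first i (h ∷ hs) y = trans (multiplicity-cellsFrom-∷ _ i h hs _)
  (trans (cong (λ s → multiplicity verticalEdges (column i h) (i , y) + s)
    (multiplicityV-left (suc i) hs y (n<1+n i))) (+-identityʳ _))

-- The first argument is the height of the column to the left (0 if there is none).
verticalCount : ℕ → List ℕ → ℕ
verticalCount p []       = 0
verticalCount p (h ∷ hs) = (h ∸ (p ∸ 1)) + suc (h ∸ 1 ∸ firstHeight hs) + verticalCount h hs

-- A vertical edge with abscissa above `i` can belong to column `i`, but to no earlier one, so of
-- the scanned columns only the last, of height `p`, has to be remembered. It starts one row lower
-- than the next column and therefore covers the lowest `p ∸ 1` rows of that column.
simpleV-cellsFrom : ∀ (M : Edge → ℕ) i p {hs} → All (1 ≤_) hs →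
  (∀ {x} y → i < x → M (x , y) ≡ multiplicity verticalEdges (cellsFrom i (p ∷ hs)) (x , y)) →
  simple M (concatMap verticalEdges (cellsFrom (suc i) hs)) ≡ verticalCount p hs
simpleV-cellsFrom M i p [] M≡ = refl
simpleV-cellsFrom M i p {suc h ∷ hs} (_ ∷ pos) M≡ = begin
  simple M (concatMap verticalEdges (cellsFrom (suc i) (suc h ∷ hs)))
    ≡⟨ simple-cellsFrom-∷ M _ (suc i) (suc h) hs ⟩
  simple M (concatMap verticalEdges (column (suc i) (suc h))) + _
    ≡⟨ cong₂ _+_ (simple-column M _ _ (λ k → (suc i , suc i + k)) (suc h)) (simpleV-cellsFrom M (suc i) (suc h) pos M≡′) ⟩
  (∑ (λ k → is1 (M (suc i , suc i + k))) (suc h) + ∑ (λ k → is1 (M (suc (suc i) , suc i + k))) (suc h))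
    + verticalCount (suc h) hs
    ≡⟨ cong (_+ verticalCount (suc h) hs) (cong₂ _+_ (lefts p leftM) rights) ⟩
  verticalCount p (suc h ∷ hs) ∎
  where
  open ≡-Reasoning
  h′ = firstHeight hs
  μ = multiplicity verticalEdges
  M≡′ : ∀ {x} y → suc i < x → M (x , y) ≡ μ (cellsFrom (suc i) (suc h ∷ hs)) (x , y)
  M≡′ y i<x = trans (M≡ y (<⇒≤ i<x)) (trans (multiplicity-cellsFrom-∷ _ i p (suc h ∷ hs) _)
    (cong (_+ _) (multiplicityV-column-other i p y (<⇒≢ (<⇒≤ i<x) ∘ sym) (<⇒≢ i<x ∘ sym))))
  leftM : ∀ k → M (suc i , suc i + k) ≡ ⟦ suc k <? p ⟧ + ⟦ k <? suc h ⟧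
  leftM k = begin
    M (suc i , suc i + k)
      ≡⟨ M≡ _ ≤-refl ⟩
    μ (cellsFrom i (p ∷ suc h ∷ hs)) (suc i , suc i + k)
      ≡⟨ multiplicity-cellsFrom-∷ _ i p (suc h ∷ hs) _ ⟩
    μ (column i p) (suc i , suc i + k) + μ (cellsFrom (suc i) (suc h ∷ hs)) (suc i , suc i + k)
      ≡⟨ cong₂ _+_ (trans (cong (λ y → μ (column i p) (suc i , y)) (sym (+-suc i k)))
                          (multiplicityV-column-side i p (suc k) (inj₂ refl)))
                   (trans (multiplicityV-first (suc i) (suc h ∷ hs) _)
                          (multiplicityV-column-side (suc i) (suc h) k (inj₁ refl))) ⟩
    ⟦ suc k <? p ⟧ + ⟦ k <? suc h ⟧ ∎
  -- Taking `p` and its equation as arguments allows a split on `p`: for `suc q` the test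
  -- `suc k <? suc q` computes to `k <? q`, and 0 stands for a missing left neighbour.
  lefts : ∀ p → (∀ k → M (suc i , suc i + k) ≡ ⟦ suc k <? p ⟧ + ⟦ k <? suc h ⟧) →
    ∑ (λ k → is1 (M (suc i , suc i + k))) (suc h) ≡ suc h ∸ (p ∸ 1)
  lefts zero    eq = trans (∑-cong (suc h) (λ k → cong is1 (eq k))) (∑-is1-outside 0 (suc h))
  lefts (suc q) eq = trans (∑-cong (suc h) (λ k → cong is1 (eq k))) (∑-is1-outside q (suc h))
  rightM : ∀ y k → y ≡ suc i + k →
    M (suc (suc i) , y) ≡ μ (column (suc (suc i)) h′) (suc (suc i) , y) + ⟦ k <? suc h ⟧
  rightM _ k refl = begin
    M (suc (suc i) , suc i + k)
      ≡⟨ M≡′ _ ≤-refl ⟩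
    μ (cellsFrom (suc i) (suc h ∷ hs)) (suc (suc i) , suc i + k)
      ≡⟨ multiplicity-cellsFrom-∷ _ (suc i) (suc h) hs _ ⟩
    μ (column (suc i) (suc h)) (suc (suc i) , suc i + k) + μ (cellsFrom (suc (suc i)) hs) (suc (suc i) , suc i + k)
      ≡⟨ cong₂ _+_ (multiplicityV-column-side (suc i) (suc h) k (inj₂ refl))
                   (multiplicityV-first (suc (suc i)) hs _) ⟩
    ⟦ k <? suc h ⟧ + μ (column (suc (suc i)) h′) (suc (suc i) , suc i + k)
      ≡⟨ +-comm ⟦ k <? suc h ⟧ _ ⟩
    μ (column (suc (suc i)) h′) (suc (suc i) , suc i + k) + ⟦ k <? suc h ⟧ ∎
  -- The next column starts one row higher. So the right side of the lowest cell is always free,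
  -- which gives the `suc`, and cell `suc k` faces cell `k` of the next column.
  rights : ∑ (λ k → is1 (M (suc (suc i) , suc i + k))) (suc h) ≡ suc (h ∸ h′)
  rights = cong₂ _+_
    (cong is1 (trans (rightM _ 0 refl)
      (cong (_+ 1) (multiplicityV-column-below (suc (suc i)) h′ _ (s≤s (s≤s (subst (_≤ i) (sym (+-identityʳ i)) ≤-refl)))))))
    (trans (∑-cong h λ k → cong is1 (trans (rightM _ (suc k) refl)
        (cong (_+ ⟦ suc k <? suc h ⟧)
          (trans (cong (λ y → μ (column (suc (suc i)) h′) (suc (suc i) , y)) (cong suc (+-suc i k)))
                 (multiplicityV-column-side (suc (suc i)) h′ k (inj₁ refl))))))
      (∑-is1-outside h′ h))

-- The vertical semiperimeter in terms of the heights

semiperimeter : ℕ → List ℕ → ℕ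
semiperimeter h []        = h
semiperimeter h (h′ ∷ hs) = suc (h ∸ 1 ∸ h′) + semiperimeter h′ hs

x+[y∸x]≡y+[x∸y] : ∀ x y → x + (y ∸ x) ≡ y + (x ∸ y)
x+[y∸x]≡y+[x∸y] zero    zero    = refl
x+[y∸x]≡y+[x∸y] zero    (suc y) = cong suc (sym (+-identityʳ y))
x+[y∸x]≡y+[x∸y] (suc x) zero    = cong suc (+-identityʳ x)
x+[y∸x]≡y+[x∸y] (suc x) (suc y) = cong suc (x+[y∸x]≡y+[x∸y] x y)

-- For positive heights `semiperimeter` counts the free right sides, and there are as many free left
-- sides. The leading `h` counts the left sides of the first column; at each later column free left
-- sides are traded for free right sides by `x+[y∸x]≡y+[x∸y]`, both of whose sides are a maximum.
double-semiperimeter : ∀ {h hs} → All (1 ≤_) (h ∷ hs) →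
  h + (suc (h ∸ 1 ∸ firstHeight hs) + verticalCount h hs) ≡ 2 * semiperimeter h hs
double-semiperimeter {suc h} {[]}      (_ ∷ [])  = refl
double-semiperimeter {suc h} {h′ ∷ hs} (_ ∷ pos) = begin
  suc h + (suc D + ((U + W) + R))            ≡⟨ regroup h D U W R ⟩
  suc (h + U) + suc D + (W + R)              ≡⟨ cong (λ s → suc s + suc D + (W + R)) (x+[y∸x]≡y+[x∸y] h h′) ⟩
  suc (h′ + D) + suc D + (W + R)             ≡⟨ collect h′ D (W + R) ⟩
  2 * suc D + (h′ + (W + R))                 ≡⟨ cong (λ s → 2 * suc D + s) (double-semiperimeter pos) ⟩
  2 * suc D + 2 * semiperimeter h′ hs        ≡⟨ *-distribˡ-+ 2 (suc D) _ ⟨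
  2 * (suc D + semiperimeter h′ hs) ∎
  where
  open ≡-Reasoning
  D = h ∸ h′
  U = h′ ∸ h
  W = suc (h′ ∸ 1 ∸ firstHeight hs)
  R = verticalCount h′ hs
  regroup : ∀ h D U W R → suc h + (suc D + ((U + W) + R)) ≡ suc (h + U) + suc D + (W + R)
  regroup = solve-∀
  collect : ∀ h′ D S → suc (h′ + D) + suc D + S ≡ 2 * suc D + (h′ + S)
  collect = solve-∀

horizontalBoundary : ∀ {hs} → All (1 ≤_) hs →
  length (boundaryEdges horizontalEdges (cellsFrom 1 hs)) ≡ 2 * length hs
horizontalBoundary {hs} pos =
  simpleH-cellsFrom (multiplicity horizontalEdges (cellsFrom 1 hs)) 1 pos (λ _ _ → refl)

verticalBoundary : ∀ {h hs} → All (1 ≤_) (h ∷ hs) →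
  length (boundaryEdges verticalEdges (cellsFrom 1 (h ∷ hs))) ≡ 2 * semiperimeter h hs
verticalBoundary {h} {hs} pos = trans
  -- The scan starts behind a fictitious column 0 of height 0, which has no cells.
  (simpleV-cellsFrom (multiplicity verticalEdges (cellsFrom 1 (h ∷ hs))) 0 0 pos (λ _ _ → refl))
  (trans (+-assoc h _ _) (double-semiperimeter pos))

-- Sequences against heights read backwards

-- Generalised over the part already reversed. The entry `y` heads both lists on the right, so that
-- the pair joining `xs` to `y` is counted too; `swap` appears because the pairs of `xs` are
-- traversed in the opposite direction.
count-consecutive-ʳ++ : ∀ {P : ℕ × ℕ → Set} (P? : Decidable P) xs y ys →
  count P? (consecutive (xs ʳ++ (y ∷ ys))) ≡
  count (P? ∘ swap) (consecutive (y ∷ xs)) + count P? (consecutive (y ∷ ys))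
count-consecutive-ʳ++ P? []       y ys = refl
count-consecutive-ʳ++ P? (x ∷ xs) y ys = begin
  count P? (consecutive (xs ʳ++ (x ∷ y ∷ ys)))
    ≡⟨ count-consecutive-ʳ++ P? xs x (y ∷ ys) ⟩
  c + count P? (consecutive (x ∷ y ∷ ys))
    ≡⟨ cong (λ s → c + s) (count-∷ P? (x , y) _) ⟩
  c + (⟦ P? (x , y) ⟧ + count P? (consecutive (y ∷ ys)))
    ≡⟨ x∙yz≈y∙xz c ⟦ P? (x , y) ⟧ (count P? (consecutive (y ∷ ys))) ⟩
  ⟦ P? (x , y) ⟧ + (c + count P? (consecutive (y ∷ ys)))
    ≡⟨ +-assoc ⟦ P? (x , y) ⟧ c _ ⟨
  ⟦ P? (x , y) ⟧ + c + count P? (consecutive (y ∷ ys))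
    ≡⟨ cong (_+ _) (count-∷ (P? ∘ swap) (y , x) (consecutive (x ∷ xs))) ⟨
  count (P? ∘ swap) (consecutive (y ∷ x ∷ xs)) + count P? (consecutive (y ∷ ys)) ∎
  where
  open ≡-Reasoning
  c = count (P? ∘ swap) (consecutive (x ∷ xs))

count-consecutive-reverse : ∀ {P : ℕ × ℕ → Set} (P? : Decidable P) xs →
  count P? (consecutive (reverse xs)) ≡ count (P? ∘ swap) (consecutive xs)
count-consecutive-reverse P? []       = refl
count-consecutive-reverse P? (x ∷ xs) = trans (count-consecutive-ʳ++ P? xs x []) (+-identityʳ _)

count-consecutive-map : ∀ {P Q : ℕ × ℕ → Set} (P? : Decidable P) (Q? : Decidable Q) (f : ℕ → ℕ) →
  (∀ x y → P (f x , f y) ⇔ Q (x , y)) →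
  ∀ xs → count P? (consecutive (map f xs)) ≡ count Q? (consecutive xs)
count-consecutive-map P? Q? f P⇔Q []           = refl
count-consecutive-map P? Q? f P⇔Q (x ∷ [])     = refl
count-consecutive-map P? Q? f P⇔Q (x ∷ y ∷ xs) = begin
  count P? (consecutive (map f (x ∷ y ∷ xs)))
    ≡⟨ count-∷ P? _ _ ⟩
  ⟦ P? (f x , f y) ⟧ + count P? (consecutive (map f (y ∷ xs)))
    ≡⟨ cong₂ _+_ (⟦⟧-cong (P⇔Q x y) (P? _) (Q? _)) (count-consecutive-map P? Q? f P⇔Q (y ∷ xs)) ⟩
  ⟦ Q? (x , y) ⟧ + count Q? (consecutive (y ∷ xs))
    ≡⟨ count-∷ Q? _ _ ⟨
  count Q? (consecutive (x ∷ y ∷ xs)) ∎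
  where open ≡-Reasoning

des-reverse : ∀ as → des (reverse as) ≡ asc as
des-reverse = count-consecutive-reverse _

lev-reverse : ∀ as → lev (reverse as) ≡ lev as
lev-reverse as = trans (count-consecutive-reverse _ as)
  -- Inserting `map id` lets `count-consecutive-map` exchange the swapped equality test for the
  -- original one.
  (trans (cong (count _ ∘ consecutive) (sym (map-id as)))
         (count-consecutive-map _ _ id (λ x y → mk⇔ sym sym) as))

-- The entries to the right of `h` in the reversal are those that `newMinima` has already passed, so
-- both tests at `h` agree. The hypothesis characterises `μ` as the minimum of `ys` by what lies
-- below it.
rlmin-ʳ++ : ∀ μ hs ys → (∀ z → z < μ ⇔ All (z <_) ys) →
  rlmin (hs ʳ++ ys) ≡ newMinima μ hs + rlmin ys
rlmin-ʳ++ μ []       ys μ⇔ = refl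
rlmin-ʳ++ μ (h ∷ hs) ys μ⇔ = begin
  rlmin (hs ʳ++ (h ∷ ys))
    ≡⟨ rlmin-ʳ++ (μ ⊓ h) hs (h ∷ ys) (λ z → mk⇔
         (λ z<μ⊓h → <-≤-trans z<μ⊓h (m⊓n≤n μ h) ∷ to (μ⇔ z) (<-≤-trans z<μ⊓h (m⊓n≤m μ h)))
         (λ { (z<h ∷ z<ys) → ⊓-glb (from (μ⇔ z) z<ys) z<h })) ⟩
  N + (⟦ all? (h <?_) ys ⟧ + rlmin ys)
    ≡⟨ cong (λ s → N + (s + rlmin ys)) (⟦⟧-cong (μ⇔ h) (h <? μ) (all? (h <?_) ys)) ⟨
  N + (⟦ h <? μ ⟧ + rlmin ys)
    ≡⟨ x∙yz≈y∙xz N ⟦ h <? μ ⟧ (rlmin ys) ⟩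
  ⟦ h <? μ ⟧ + (N + rlmin ys)
    ≡⟨ +-assoc ⟦ h <? μ ⟧ N (rlmin ys) ⟨
  newMinima μ (h ∷ hs) + rlmin ys ∎
  where
  open ≡-Reasoning
  open Equivalence
  N = newMinima (μ ⊓ h) hs

rlmin-reverse : ∀ hs → rlmin (reverse hs) ≡ lmin hs
rlmin-reverse []       = refl
rlmin-reverse (h ∷ hs) = trans
  (rlmin-ʳ++ h hs (h ∷ []) λ z → mk⇔ (λ z<h → z<h ∷ []) All.head)
  (+-comm (newMinima h hs) 1)

excesses : List ℕ → ℕ
excesses as = sum (map (λ p → proj₂ p ∸ proj₁ p ∸ 1) (consecutive as))

-- The reversal begins with the last height, the initial term of both quantities. Every further
-- column adds the same excess on both sides, and its extra `suc` in `semiperimeter` is matched by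
-- `length hs`.
exc-ʳ++ : ∀ h hs ys → exc (hs ʳ++ (h ∷ ys)) + length hs ≡ semiperimeter h hs + excesses (h ∷ ys)
exc-ʳ++ h []        ys = +-identityʳ _
exc-ʳ++ h (h′ ∷ hs) ys = begin
  exc (hs ʳ++ (h′ ∷ h ∷ ys)) + suc (length hs)
    ≡⟨ +-suc _ (length hs) ⟩
  suc (exc (hs ʳ++ (h′ ∷ h ∷ ys)) + length hs)
    ≡⟨ cong suc (exc-ʳ++ h′ hs (h ∷ ys)) ⟩
  suc (S + (h ∸ h′ ∸ 1 + E))
    ≡⟨ cong (λ s → suc (S + (s + E))) (trans (∸-+-assoc h h′ 1)
         (trans (cong (h ∸_) (+-comm h′ 1)) (sym (∸-+-assoc h 1 h′)))) ⟩
  suc (S + (D + E))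
    ≡⟨ cong suc (x∙yz≈y∙xz S D E) ⟩
  suc (D + (S + E))
    ≡⟨ cong suc (+-assoc D S E) ⟨
  semiperimeter h (h′ ∷ hs) + excesses (h ∷ ys) ∎
  where
  open ≡-Reasoning
  S = semiperimeter h′ hs
  D = h ∸ 1 ∸ h′
  E = excesses (h ∷ ys)

exc-reverse : ∀ h hs → exc (reverse (h ∷ hs)) + length hs ≡ semiperimeter h hs
exc-reverse h hs = trans (exc-ʳ++ h hs []) (+-identityʳ _)

-- Shifting a sequence by two and prepending 1

2+ : ℕ → ℕ
2+ a = suc (suc a)

2+-injective : Injective _≡_ _≡_ 2+
2+-injective refl = refl

2+-<⇔ : ∀ x y → (2+ x < 2+ y) ⇔ (x < y)
2+-<⇔ x y = mk⇔ (λ { (s≤s (s≤s p)) → p }) (λ p → s≤s (s≤s p))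

asc-map-2+ : ∀ as → asc (map 2+ as) ≡ asc as
asc-map-2+ = count-consecutive-map _ _ 2+ 2+-<⇔

lev-map-2+ : ∀ as → lev (map 2+ as) ≡ lev as
lev-map-2+ = count-consecutive-map _ _ 2+ λ x y → mk⇔ 2+-injective (cong 2+)

excesses-map-2+ : ∀ as → excesses (map 2+ as) ≡ excesses as
excesses-map-2+ []           = refl
excesses-map-2+ (a ∷ [])     = refl
excesses-map-2+ (a ∷ b ∷ as) = cong (λ s → b ∸ a ∸ 1 + s) (excesses-map-2+ (b ∷ as))

rlmin-map-2+ : ∀ as → rlmin (map 2+ as) ≡ rlmin as
rlmin-map-2+ []       = refl
rlmin-map-2+ (a ∷ as) = cong₂ _+_
  (⟦⟧-cong (mk⇔ (All.map (to (2+-<⇔ _ _)) ∘ All.map⁻) (All.map⁺ ∘ All.map (from (2+-<⇔ _ _))))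
           (all? (2+ a <?_) (map 2+ as)) (all? (a <?_) as))
  (rlmin-map-2+ as)
  where open Equivalence

exc-map-2+ : ∀ a as → exc (map 2+ (a ∷ as)) ≡ 2+ (exc (a ∷ as))
exc-map-2+ a as = cong (λ s → 2+ a + s) (excesses-map-2+ (a ∷ as))

asc-1∷map-2+ : ∀ a as → asc (1 ∷ map 2+ (a ∷ as)) ≡ suc (asc (a ∷ as))
asc-1∷map-2+ a as = cong suc (asc-map-2+ (a ∷ as))

lev-1∷map-2+ : ∀ as → lev (1 ∷ map 2+ as) ≡ lev as
lev-1∷map-2+ []       = refl
lev-1∷map-2+ (a ∷ as) = lev-map-2+ (a ∷ as)

rlmin-1∷map-2+ : ∀ as → rlmin (1 ∷ map 2+ as) ≡ suc (rlmin as)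
rlmin-1∷map-2+ as = cong₂ _+_
  (⟦⟧-true (all? (1 <?_) (map 2+ as)) (All.map⁺ (All.universal (λ _ → s≤s (s≤s z≤n)) as)))
  (rlmin-map-2+ as)

-- The excess of `2+ a` over the new first entry 1 is `a`, so the old first term survives as an
-- excess and only the leading 1 is added.
exc-1∷map-2+ : ∀ a as → exc (1 ∷ map 2+ (a ∷ as)) ≡ suc (exc (a ∷ as))
exc-1∷map-2+ a as = cong (λ s → suc (a + s)) (excesses-map-2+ (a ∷ as))

-- Conditions on polyominoes turned into conditions on sequences

≡-congˡ : ∀ {A : Set} {x y : A} → x ≡ y → ∀ {z} → (x ≡ z) ⇔ (y ≡ z)
≡-congˡ refl = mk⇔ id id

+-injective⇔ : ∀ {x y} → (x ≡ y) ⇔ (+ x ≡ + y)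
+-injective⇔ = mk⇔ (λ { refl → refl }) ℤ.+-injective

≡-sub⇔ : ∀ {x : ℕ} {i : ℤ} y → (+ (x + y) ≡ i) ⇔ (+ x ≡ i - + y)
≡-sub⇔ {x} {i} y = mk⇔
  (λ { refl → sym (//-rightDividesʳ (+ y) (+ x)) })
  (λ eq → trans (cong (ℤ._+ + y) eq) (//-rightDividesˡ (+ y) i))

suc≡⇔ : ∀ {x d} → (suc x ≡ d) ⇔ (+ x ≡ + d - 1ℤ)
suc≡⇔ {x} = ≡-sub⇔ 1 ⇔-∘ +-injective⇔ ⇔-∘ ≡-congˡ (+-comm 1 x)

-- The vertical condition `n = exc as + (m - 1)` is put additively to avoid truncated subtraction.
ReversedHeights : (m n d j t : ℕ) → List ℕ → Set
ReversedHeights m n d j t as =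
  length as ≡ m × exc as + m ≡ suc n × asc as ≡ d × rlmin as ≡ j × lev as ≡ t

Counted : (m n d j t : ℕ) → FibonacciPolyomino → Set
Counted m n d j t P =
  P ∈𝓕[ m , n ] × des (heights P) ≡ d × lmin (heights P) ≡ j × lev (heights P) ≡ t

fibonacci⇒positive : ∀ {hs} → FibonacciHeights hs → All (1 ≤_) hs
fibonacci⇒positive (last 1≤h)       = 1≤h ∷ []
fibonacci⇒positive (before 2≤h fib) = ≤-trans (s≤s z≤n) 2≤h ∷ fibonacci⇒positive fib

double⇔ : ∀ {x a b} → x ≡ 2 * a → (x ≡ 2 * b) ⇔ (a ≡ b)
double⇔ {a = a} {b} refl = mk⇔ (*-cancelˡ-≡ a b 2) (cong (2 *_))

∈𝓕⇔ : ∀ {m n} hs fib →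
  (polyomino hs fib ∈𝓕[ m , n ]) ⇔ (length hs ≡ m × exc (reverse hs) + m ≡ suc n)
∈𝓕⇔ []       ()
∈𝓕⇔ {m} {n} (h ∷ hs) fib = mk⇔
  (λ { (eH , eV) → semiperimeter⇒exc (to H eH) (to V eV) })
  (λ { (eL , eE) → from H eL , from V (exc⇒semiperimeter eL eE) })
  where
  open Equivalence
  pos = fibonacci⇒positive fib
  H = double⇔ {b = m} (horizontalBoundary pos)
  V = double⇔ {b = n} (verticalBoundary pos)
  suc-semiperimeter : exc (reverse (h ∷ hs)) + suc (length hs) ≡ suc (semiperimeter h hs)
  suc-semiperimeter = trans (+-suc _ _) (cong suc (exc-reverse h hs))
  semiperimeter⇒exc : length (h ∷ hs) ≡ m → semiperimeter h hs ≡ n →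
    length (h ∷ hs) ≡ m × exc (reverse (h ∷ hs)) + m ≡ suc n
  semiperimeter⇒exc refl refl = refl , suc-semiperimeter
  exc⇒semiperimeter : length (h ∷ hs) ≡ m → exc (reverse (h ∷ hs)) + m ≡ suc n → semiperimeter h hs ≡ n
  exc⇒semiperimeter refl eq = suc-injective (trans (sym suc-semiperimeter) eq)

counted⇔ : ∀ {m n d j t} as (fib : FibonacciHeights (reverse as)) →
  Counted m n d j t (polyomino (reverse as) fib) ⇔ ReversedHeights m n d j t as
counted⇔ as fib = mk⇔ (λ { ((l , e) , rest) → l , e , rest }) (λ { (l , e , rest) → (l , e) , rest })
  ⇔-∘ ((≡-congˡ (length-reverse as) ×-⇔ ≡-congˡ (cong (λ g → exc g + _) (reverse-involutive as))) ⇔-∘ ∈𝓕⇔ _ fib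
       ×-⇔ ≡-congˡ (des-reverse as)
       ×-⇔ ≡-congˡ (trans (sym (rlmin-reverse (reverse as))) (cong rlmin (reverse-involutive as)))
       ×-⇔ ≡-congˡ (lev-reverse as))

IsSequence : (ℓ : ℕ) (r d j t : ℤ) → List ℕ → Set
IsSequence ℓ r d j t as =
  length as ≡ ℓ × + exc as ≡ r × + asc as ≡ d × + rlmin as ≡ j × + lev as ≡ t

-- On a nonempty sequence the shift adds 2 to `exc`, so `exc as + 2 + m = n + 1`, which is the value
-- `n - m - 1` of the first summand.
last≥2⇔ : ∀ {m n d j t} as → 1 ≤ length as →
  ReversedHeights m n d j t (map 2+ as) ⇔ IsSequence m (+ n - + m - 1ℤ) (+ d) (+ j) (+ t) as
last≥2⇔ {m} {n} (a ∷ as) _ =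
  ≡-congˡ (length-map 2+ (a ∷ as))
  -- Read from right to left: cancel one `suc`, pass to ℤ, then move `m` and the remaining 1 across.
  ×-⇔ (≡-sub⇔ 1 ⇔-∘ ≡-sub⇔ m ⇔-∘ +-injective⇔ ⇔-∘ ≡-congˡ (cong (_+ m) (+-comm 1 (exc (a ∷ as))))
       ⇔-∘ mk⇔ suc-injective (cong suc) ⇔-∘ ≡-congˡ (cong (_+ m) (exc-map-2+ a as)))
  ×-⇔ (+-injective⇔ ⇔-∘ ≡-congˡ (asc-map-2+ (a ∷ as)))
  ×-⇔ (+-injective⇔ ⇔-∘ ≡-congˡ (rlmin-map-2+ (a ∷ as)))
  ×-⇔ (+-injective⇔ ⇔-∘ ≡-congˡ (lev-map-2+ (a ∷ as)))

-- The prepended 1 adds only 1 to `exc`, and this cancels the 1 in `suc n`, leaving `n` minus the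
-- number `suc m` of columns. With `as` nonempty, the prepended 1 starts an ascent.
last≡1⇔ : ∀ {m n d j t} as → 1 ≤ length as →
  ReversedHeights (suc m) n d j t (1 ∷ map 2+ as) ⇔
  IsSequence m (+ n - + suc m) (+ d - 1ℤ) (+ j - 1ℤ) (+ t) as
last≡1⇔ {m} {n} (a ∷ as) _ =
  (≡-congˡ (length-map 2+ (a ∷ as)) ⇔-∘ mk⇔ suc-injective (cong suc))
  ×-⇔ (≡-sub⇔ (suc m) ⇔-∘ +-injective⇔ ⇔-∘ mk⇔ suc-injective (cong suc)
       ⇔-∘ ≡-congˡ (cong (_+ suc m) (exc-1∷map-2+ a as)))
  ×-⇔ (suc≡⇔ ⇔-∘ ≡-congˡ (asc-1∷map-2+ a as))
  ×-⇔ (suc≡⇔ ⇔-∘ ≡-congˡ (rlmin-1∷map-2+ (a ∷ as)))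
  ×-⇔ (+-injective⇔ ⇔-∘ ≡-congˡ (lev-1∷map-2+ (a ∷ as)))

-- The case split on the last column

fibonacci-ʳ++ : ∀ {hs} as → FibonacciHeights hs → FibonacciHeights (map 2+ as ʳ++ hs)
fibonacci-ʳ++ []       fib = fib
fibonacci-ʳ++ (a ∷ as) fib = fibonacci-ʳ++ as (before (s≤s (s≤s z≤n)) fib)

fibonacci-last≥2 : ∀ as → 1 ≤ length as → FibonacciHeights (reverse (map 2+ as))
fibonacci-last≥2 (a ∷ as) _ = fibonacci-ʳ++ as (last (s≤s z≤n))

fibonacci-last≡1 : ∀ as → FibonacciHeights (reverse (1 ∷ map 2+ as))
fibonacci-last≡1 as = fibonacci-ʳ++ as (last ≤-refl)

-- A view of height lists whose constructors carry the sequence that a list comes from.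
data LastHeight : List ℕ → Set where
  last≥2 : ∀ as → LastHeight (reverse (map 2+ as))
  last≡1 : ∀ as → LastHeight (reverse (1 ∷ map 2+ as))

reverse-map-∷ʳ : ∀ (f : ℕ → ℕ) as a → reverse (map f (as ∷ʳ a)) ≡ f a ∷ reverse (map f as)
reverse-map-∷ʳ f as a = trans (cong reverse (map-++ f as (a ∷ []))) (reverse-++ (map f as) (f a ∷ []))

-- The last column decides the constructor. Each column to its left has some height `2+ a` and
-- appends `a` at the far end, since the sequence runs backwards.
lastHeight : ∀ {hs} → FibonacciHeights hs → LastHeight hs
lastHeight (last {suc zero}    _) = last≡1 []
lastHeight (last {suc (suc a)} _) = last≥2 (a ∷ [])
lastHeight (before {suc (suc a)} _ fib) with lastHeight fib
... | last≥2 as = subst LastHeight (reverse-map-∷ʳ 2+ as a) (last≥2 (as ∷ʳ a))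
... | last≡1 as = subst LastHeight eq (last≡1 (as ∷ʳ a))
  where
  eq : reverse (1 ∷ map 2+ (as ∷ʳ a)) ≡ 2+ a ∷ reverse (1 ∷ map 2+ as)
  eq = trans (cong (λ g → reverse (1 ∷ g)) (map-++ 2+ as (a ∷ []))) (reverse-++ (1 ∷ map 2+ as) (2+ a ∷ []))
lastHeight (before {suc zero} (s≤s ()) _)

last≥2≢last≡1 : ∀ as bs → reverse (map 2+ as) ≢ reverse (1 ∷ map 2+ bs)
last≥2≢last≡1 as bs eq = go as (reverse-injective eq)
  where
  go : ∀ as → map 2+ as ≢ 1 ∷ map 2+ bs
  go []       ()
  go (a ∷ as) ()

-- Uniqueness of proofs and the bijection

fibonacci-irrelevant : ∀ {hs} (p q : FibonacciHeights hs) → p ≡ q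
fibonacci-irrelevant (last p)      (last q)      = cong last (≤-irrelevant p q)
fibonacci-irrelevant (last _)      (before _ ())
fibonacci-irrelevant (before _ ()) (last _)
fibonacci-irrelevant (before p ps) (before q qs) = cong₂ before (≤-irrelevant p q) (fibonacci-irrelevant ps qs)

-- Ensures that the cardinality of the Σ-type counts polyominoes and not the proofs attached to
-- them.
counted-≡ : ∀ {m n d j t} {u v : Σ[ P ∈ FibonacciPolyomino ] Counted m n d j t P} →
  heights (proj₁ u) ≡ heights (proj₁ v) → u ≡ v
counted-≡ {m} {n} {d} {j} {t} {u = polyomino hs p , c} {v = polyomino .hs q , c′} refl
  with refl ← fibonacci-irrelevant p q =
  cong (polyomino hs p ,_) (irr (polyomino hs p) c c′)
  where
  irr : ∀ P (c c′ : Counted m n d j t P) → c ≡ c′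
  irr P ((e₁ , e₂) , e₃ , e₄ , e₅) ((e₁′ , e₂′) , e₃′ , e₄′ , e₅′) =
    cong₂ _,_ (cong₂ _,_ (≡-irrelevant e₁ e₁′) (≡-irrelevant e₂ e₂′))
      (cong₂ _,_ (≡-irrelevant e₃ e₃′) (cong₂ _,_ (≡-irrelevant e₄ e₄′) (≡-irrelevant e₅ e₅′)))

isSequence-irrelevant : ∀ {ℓ r d j t as} (c c′ : IsSequence ℓ r d j t as) → c ≡ c′
isSequence-irrelevant (refl , refl , refl , refl , refl) (refl , refl , refl , refl , refl) = refl

sequences-≡ : ∀ {ℓ r d j t} {u v : Sequences ℓ r d j t} → proj₁ u ≡ proj₁ v → u ≡ v
sequences-≡ {u = as , c} {v = .as , c′} refl = cong (as ,_) (isSequence-irrelevant {as = as} c c′)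

-- With `2+ m` columns both sequence lengths are positive, as `last≥2⇔` and `last≡1⇔` demand. The
-- two images are disjoint because their last heights differ.
sequences↔polyominoes : ∀ {m n d j t} →
  (Sequences (2+ m) (+ n - + 2+ m - 1ℤ) (+ d) (+ j) (+ t) ⊎
   Sequences (suc m) (+ n - + 2+ m) (+ d - 1ℤ) (+ j - 1ℤ) (+ t)) ↔
  (Σ[ P ∈ FibonacciPolyomino ] Counted (2+ m) n d j t P)
sequences↔polyominoes {m} {n} {d} {j} {t} = ⤖⇒↔ (mk⤖ (injective , surjective))
  where
  open Equivalence
  S₁ = Sequences (2+ m) (+ n - + 2+ m - 1ℤ) (+ d) (+ j) (+ t)
  S₂ = Sequences (suc m) (+ n - + 2+ m) (+ d - 1ℤ) (+ j - 1ℤ) (+ t)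
  T = Σ[ P ∈ FibonacciPolyomino ] Counted (2+ m) n d j t P

  nonempty : ∀ {ℓ} (as : List ℕ) → length as ≡ suc ℓ → 1 ≤ length as
  nonempty as eq = subst (1 ≤_) (sym eq) (s≤s z≤n)

  assemble : S₁ ⊎ S₂ → T
  assemble (inj₁ (as , c)) = polyomino _ fib ,
    from (counted⇔ {2+ m} {n} (map 2+ as) fib) (from (last≥2⇔ {2+ m} {n} as ne) c)
    where
    ne = nonempty as (proj₁ c)
    fib = fibonacci-last≥2 as ne
  assemble (inj₂ (as , c)) = polyomino _ fib ,
    from (counted⇔ {2+ m} {n} (1 ∷ map 2+ as) fib) (from (last≡1⇔ {suc m} {n} as (nonempty as (proj₁ c))) c)
    where
    fib = fibonacci-last≡1 as

  injective : Injective _≡_ _≡_ assemble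
  injective {inj₁ (as , _)} {inj₁ (bs , _)} eq = cong inj₁ (sequences-≡
    (map-injective 2+-injective (reverse-injective (cong (heights ∘ proj₁) eq))))
  injective {inj₁ (as , _)} {inj₂ (bs , _)} eq =
    contradiction (cong (heights ∘ proj₁) eq) (last≥2≢last≡1 as bs)
  injective {inj₂ (as , _)} {inj₁ (bs , _)} eq =
    contradiction (sym (cong (heights ∘ proj₁) eq)) (last≥2≢last≡1 bs as)
  injective {inj₂ (as , _)} {inj₂ (bs , _)} eq = cong inj₂ (sequences-≡
    (map-injective 2+-injective (∷-injectiveʳ (reverse-injective (cong (heights ∘ proj₁) eq)))))

  -- Only the heights have to match here; `counted-≡` upgrades this to equality below.
  preimage : ∀ {hs} → LastHeight hs → (fib : FibonacciHeights hs) → Counted (2+ m) n d j t (polyomino hs fib) →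
    ∃ λ s → heights (proj₁ (assemble s)) ≡ hs
  preimage (last≥2 as) fib c = inj₁ (as , to (last≥2⇔ {2+ m} {n} as ne) r) , refl
    where
    r = to (counted⇔ {2+ m} {n} (map 2+ as) fib) c
    ne = nonempty as (trans (sym (length-map 2+ as)) (proj₁ r))
  preimage (last≡1 as) fib c = inj₂ (as , to (last≡1⇔ {suc m} {n} as ne) r) , refl
    where
    r = to (counted⇔ {2+ m} {n} (1 ∷ map 2+ as) fib) c
    ne = nonempty as (trans (sym (length-map 2+ as)) (suc-injective (proj₁ r)))

  surjective : ∀ u → ∃ λ s → ∀ {z} → z ≡ s → assemble z ≡ u
  surjective (polyomino hs fib , c) with s , eq ← preimage (lastHeight fib) fib c =
    s , λ { refl → counted-≡ {2+ m} {n} eq }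

-- Finiteness

lookup-injective : ∀ {A : Set} {xs : List A} → Unique xs → Injective _≡_ _≡_ (lookup xs)
lookup-injective (x∉xs ∷ u) {zero}  {zero}  eq = refl
lookup-injective (x∉xs ∷ u) {zero}  {suc j} eq = contradiction eq (All.lookup x∉xs (∈-lookup j))
lookup-injective (x∉xs ∷ u) {suc i} {zero}  eq = contradiction (sym eq) (All.lookup x∉xs (∈-lookup i))
lookup-injective (x∉xs ∷ u) {suc i} {suc j} eq = cong suc (lookup-injective u eq)

-- Filtering and deduplicating `xs` lists every element of the subset exactly once, so positions in
-- that list are in bijection with the subset.
subset-finite : ∀ {A : Set} (_≟ᴬ_ : DecidableEquality A) {P : A → Set} (P? : Decidable P) →
  (∀ {x} (p q : P x) → p ≡ q) → (xs : List A) → (∀ {x} → P x → x ∈ xs) →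
  ∃ λ k → (Σ[ x ∈ A ] P x) HasCardinality k
subset-finite {A} _≟ᴬ_ {P} P? irr xs P⊆xs = length ys , ↔-sym (⤖⇒↔ (mk⤖ (injective , surjective)))
  where
  ys = deduplicate _≟ᴬ_ (filter P? xs)

  element : Fin (length ys) → Σ[ x ∈ A ] P x
  element i = lookup ys i , proj₂ (∈-filter⁻ P? {xs = xs} (∈-deduplicate⁻ _≟ᴬ_ (filter P? xs) (∈-lookup i)))

  injective : Injective _≡_ _≡_ element
  injective eq = lookup-injective (deduplicate-! _≟ᴬ_ (filter P? xs)) (cong proj₁ eq)

  element-≡ : ∀ {u v : Σ[ x ∈ A ] P x} → proj₁ u ≡ proj₁ v → u ≡ v
  element-≡ {x , p} {.x , q} refl = cong (x ,_) (irr p q)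

  surjective : ∀ u → ∃ λ i → ∀ {z} → z ≡ i → element z ≡ u
  surjective (x , p) = index x∈ys , λ { refl → element-≡ (sym (lookup-index x∈ys)) }
    where
    x∈ys : x ∈ ys
    x∈ys = ∈-deduplicate⁺ _≟ᴬ_ (∈-filter⁺ P? (P⊆xs p) p)

listsBelow : ℕ → ℕ → List (List ℕ)
listsBelow b zero    = [] ∷ []
listsBelow b (suc ℓ) = cartesianProductWith _∷_ (upTo b) (listsBelow b ℓ)

∈-listsBelow : ∀ {b} as → All (_< b) as → as ∈ listsBelow b (length as)
∈-listsBelow []       []           = here refl
∈-listsBelow (a ∷ as) (a<b ∷ as<b) = ∈-cartesianProductWith⁺ _∷_ (∈-upTo⁺ a<b) (∈-listsBelow as as<b)

-- From one entry to the next the value grows by at most 1 plus the excess counted there, so no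
-- entry exceeds the total excess plus the number of steps. With `exc` and the length fixed, only
-- finitely many sequences remain.
entries≤ : ∀ a as → All (_≤ exc (a ∷ as) + length as) (a ∷ as)
entries≤ a []       = ≤-trans (m≤m+n a 0) (m≤m+n (a + 0) 0) ∷ []
entries≤ a (b ∷ as) =
  ≤-trans (m≤m+n a _) (m≤m+n _ (suc (length as))) ∷ All.map (λ c≤ → ≤-trans c≤ step) (entries≤ b as)
  where
  open ≤-Reasoning
  D = b ∸ a ∸ 1
  E = excesses (b ∷ as)
  L = length as
  regroup : ∀ a D E L → suc a + D + E + L ≡ a + (D + E) + suc L
  regroup = solve-∀
  step : b + E + L ≤ exc (a ∷ b ∷ as) + suc L
  step = begin
    -- This is the growth bound `b ≤ a + 1 + (b - a - 1)₊`.
    b + E + L                    ≤⟨ +-monoˡ-≤ L (+-monoˡ-≤ E (m≤n+m∸n b (suc a))) ⟩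
    suc a + (b ∸ suc a) + E + L  ≡⟨ cong (λ s → suc a + s + E + L) (trans (cong (b ∸_) (+-comm 1 a)) (sym (∸-+-assoc b a 1))) ⟩
    suc a + D + E + L            ≡⟨ regroup a D E L ⟩
    a + (D + E) + suc L ∎

entries< : ∀ as → All (_< suc (exc as + length as)) as
entries< []       = []
entries< (a ∷ as) = All.map (λ c≤ → s≤s (≤-trans c≤ (+-monoʳ-≤ (exc (a ∷ as)) (n≤1+n (length as))))) (entries≤ a as)

sequences-finite : ∀ ℓ r d j t → ∃ λ k → Sequences ℓ r d j t HasCardinality k
sequences-finite ℓ r d j t = subset-finite (≡-dec _≟_) isSequence? (λ {as} → isSequence-irrelevant {as = as})
  -- A member has `r = + exc as`, so the bound is the one in `entries<`; for negative `r` there are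
  -- no members and any list would do.
  (listsBelow (suc (∣ r ∣ + ℓ)) ℓ) λ { {as} (refl , refl , _) → ∈-listsBelow as (entries< as) }
  where
  isSequence? : Decidable (IsSequence ℓ r d j t)
  isSequence? as = length as ≟ ℓ ×-dec + exc as ℤ.≟ r ×-dec + asc as ℤ.≟ d ×-dec + rlmin as ℤ.≟ j ×-dec + lev as ℤ.≟ t

theorem4p5 : (m n d t j : ℕ) → 2 ≤ m → 2 ≤ n → 1 ≤ j →
    ∃₂ λ (s s′ : ℕ) →
    (Sequences m (+ n - + m - 1ℤ) (+ d) (+ j) (+ t) HasCardinality s) ×
    (Sequences (m ∸ 1) (+ n - + m) (+ d - 1ℤ) (+ j - 1ℤ) (+ t) HasCardinality s′) ×
    ((Σ[ P ∈ FibonacciPolyomino ]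
    (P ∈𝓕[ m , n ] × des (heights P) ≡ d × lmin (heights P) ≡ j × lev (heights P) ≡ t))
    HasCardinality (s + s′))
theorem4p5 (suc (suc m)) n d t j (s≤s (s≤s _)) _ _
  with s , S₁↔s ← sequences-finite (2+ m) (+ n - + 2+ m - 1ℤ) (+ d) (+ j) (+ t)
     | s′ , S₂↔s′ ← sequences-finite (suc m) (+ n - + 2+ m) (+ d - 1ℤ) (+ j - 1ℤ) (+ t)
  = s , s′ , S₁↔s , S₂↔s′ ,
    -- Read from right to left: polyominoes, the disjoint union of the two sequence sets,
    -- `Fin s ⊎ Fin s′`, `Fin (s + s′)`.
    ↔-sym +↔⊎ ↔-∘ ((S₁↔s ⊎-↔ S₂↔s′) ↔-∘ ↔-sym (sequences↔polyominoes {m} {n}))
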